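{- Let $G$ and $H$ be simple connected graphs, each with at least two vertices. Then the Cartesian product $G \Box H$ and the lexicographic product $G \circ H$ are not isomorphic.
   Context: All graphs are finite, undirected and simple (no loops or multiple edges). For graphs $G$ and $H$, the following products have vertex set $V(G)\times V(H)$. The Cartesian product $G \Box H$: $(x,y)\sim(x',y')$ if either ($x\sim x'$ in $G$ and $y=y'$) or ($x=x'$ and $y\sim y'$ in $H$). The lexicographic product $G\circ H$: $(x,y)\sim(x',y')$ if either $x\sim x'$ in $G$, or ($x=x'$ and $y\sim y'$ in $H$). Two graphs are isomorphic if there is a bijection between their vertex sets that preserves adjacency and non-adjacency. -}

module Defs where

open import Data.Fin.Base using (Fin)
open import Data.Fin.Properties using (*↔×; inj⇒≟)
open import Data.Nat.Base using (ℕ; _*_)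
open import Data.Product.Base using (_×_; _,_)
open import Data.Product.Function.NonDependent.Propositional using (_×-↔_)
open import Data.Sum.Base using (_⊎_; inj₁; inj₂)
open import Function.Bundles using (_↔_; _⇔_; Inverse)
open import Function.Construct.Composition using (_↔-∘_)
open import Function.Construct.Symmetry using (↔-sym)
open import Function.Properties.Inverse using (↔⇒↣)
open import Relation.Binary.Construct.Closure.ReflexiveTransitive using (Star)
open import Relation.Binary.Core using (Rel)
open import Relation.Binary.Definitions
  using (Decidable; DecidableEquality; Irreflexive; Symmetric)
open import Relation.Binary.PropositionalEquality.Core using (_≡_; refl; sym)
open import Relation.Nullary.Decidable using (_×-dec_; _⊎-dec_)
open import Level using (0ℓ)

-- Finite simple graphs. Only whether Adj x y is inhabited matters, so there
-- are no multiple edges. Decidability of adjacency, automatic classically, is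
-- part of the constructive notion of a finite graph (a finite edge set).
record Graph : Set₁ where
  field
    Vertex  : Set
    order   : ℕ
    finite  : Vertex ↔ Fin order
    Adj     : Rel Vertex 0ℓ
    adj?    : Decidable Adj
    symm    : Symmetric Adj
    irrefl  : Irreflexive _≡_ Adj

  _≟_ : DecidableEquality Vertex
  _≟_ = inj⇒≟ (↔⇒↣ finite)

open Graph

-- Star (Adj G) x y is the type of walks from x to y.
Connected : Graph → Set
Connected G = ∀ x y → Star (Adj G) x y

infix 4 _≅_

record _≅_ (G H : Graph) : Set where
  field
    bijection : Vertex G ↔ Vertex H

  open Inverse bijection public using (to; from)

  field
    adj⇔ : ∀ x y → Adj G x y ⇔ Adj H (to x) (to y)

private
  ×-finite : (G H : Graph) → (Vertex G × Vertex H) ↔ Fin (order G * order H)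
  ×-finite G H = ↔-sym (*↔× {order G} {order H}) ↔-∘ (finite G ×-↔ finite H)

infixr 7 _□_ _∘_

_□_ : Graph → Graph → Graph
G □ H = record
  { Vertex = Vertex G × Vertex H
  ; order  = order G * order H
  ; finite = ×-finite G H
  ; Adj    = λ { (x , y) (x′ , y′) →
                 (Adj G x x′ × y ≡ y′) ⊎ (x ≡ x′ × Adj H y y′) }
  ; adj?   = λ { (x , y) (x′ , y′) →
                 (adj? G x x′ ×-dec _≟_ H y y′) ⊎-dec
                 (_≟_ G x x′ ×-dec adj? H y y′) }
  ; symm   = λ { (inj₁ (a , e)) → inj₁ (symm G a , sym e)
               ; (inj₂ (e , a)) → inj₂ (sym e , symm H a) }
  ; irrefl = λ { refl (inj₁ (a , _)) → irrefl G refl a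
               ; refl (inj₂ (_ , a)) → irrefl H refl a }
  }

-- Lexicographic product (sometimes written G[H]); not function composition.
_∘_ : Graph → Graph → Graph
G ∘ H = record
  { Vertex = Vertex G × Vertex H
  ; order  = order G * order H
  ; finite = ×-finite G H
  ; Adj    = λ { (x , y) (x′ , y′) →
                 Adj G x x′ ⊎ (x ≡ x′ × Adj H y y′) }
  ; adj?   = λ { (x , y) (x′ , y′) →
                 adj? G x x′ ⊎-dec (_≟_ G x x′ ×-dec adj? H y y′) }
  ; symm   = λ { (inj₁ a)       → inj₁ (symm G a)
               ; (inj₂ (e , a)) → inj₂ (sym e , symm H a) }
  ; irrefl = λ { refl (inj₁ a)       → irrefl G refl a
               ; refl (inj₂ (_ , a)) → irrefl H refl a }
  }

{-# OPTIONS --safe #-}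

-- In G ∘ H any two neighbours of a vertex are adjacent or have a common
-- neighbour in its neighbourhood, because every neighbour along G is adjacent
-- to every neighbour along H. In G □ H a neighbour along G and one along H are
-- never adjacent, nor joined through a third neighbour.
module Submission where

open import Defs
open import Data.Fin.Base using (Fin; zero; suc)
open import Data.Nat.Base using (_≤_; z≤n; s≤s)
open import Data.Product.Base using (_×_; _,_; ∃; ∃-syntax)
open import Data.Sum.Base using (_⊎_; inj₁; inj₂)
open import Function.Base using (_$_)
open import Function.Bundles using (Inverse; Equivalence)
open import Relation.Binary.Construct.Closure.ReflexiveTransitive using (ε; _◅_)
open import Relation.Binary.PropositionalEquality
  using (_≢_; refl; sym; subst)
open import Relation.Nullary.Negation.Core using (¬_; contradiction)

open Graph

another : ∀ {n} → 2 ≤ n → (i : Fin n) → ∃[ j ] i ≢ j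
another (s≤s (s≤s z≤n)) zero    = suc zero , λ ()
another (s≤s (s≤s z≤n)) (suc _) = zero , λ ()

vertex : (G : Graph) → 2 ≤ order G → Vertex G
vertex G 2≤n = Inverse.from (finite G) (first 2≤n)
  where
  first : ∀ {n} → 2 ≤ n → Fin n
  first (s≤s _) = zero

-- A walk from `x` to any second vertex cannot be empty, so its first step supplies the neighbour.
neighbour : (G : Graph) → Connected G → 2 ≤ order G → ∀ x → ∃ (Adj G x)
neighbour G conn 2≤n x with another 2≤n (Inverse.to (finite G) x)
... | j , x≢j with conn x (Inverse.from (finite G) j)
...   | a ◅ _ = _ , a
...   | ε     = contradiction (Inverse.strictlyInverseˡ (finite G) j) x≢j

-- For neighbours `u`, `w` of `v`: a walk of length one or two inside the subgraph induced on the
-- neighbourhood of `v`.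
Linked : (G : Graph) → Vertex G → Vertex G → Vertex G → Set
Linked G v u w = Adj G u w ⊎ ∃[ z ] (Adj G v z × Adj G u z × Adj G w z)

∘-linked : (G H : Graph) → (∀ x → ∃ (Adj G x)) → (∀ y → ∃ (Adj H y)) →
           ∀ v u w → Adj (G ∘ H) v u → Adj (G ∘ H) v w → Linked (G ∘ H) v u w
-- Both neighbours lie outside the copy of `H` over `x`, hence are adjacent to all of it, in
-- particular to a neighbour of `(x , y)` there.
∘-linked G H nG nH (x , y) _ _ (inj₁ a) (inj₁ b) with nH y
... | y′ , c = inj₂ ((x , y′) , inj₂ (refl , c) , inj₁ (symm G a) , inj₁ (symm G b))
∘-linked G H nG nH _ _ _ (inj₁ a) (inj₂ (refl , _)) = inj₁ (inj₁ (symm G a))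
∘-linked G H nG nH _ _ _ (inj₂ (refl , _)) (inj₁ b) = inj₁ (inj₁ b)
-- All three vertices lie in one copy of `H`, so any vertex of an adjacent copy serves.
∘-linked G H nG nH (x , y) _ _ (inj₂ (refl , _)) (inj₂ (refl , _)) with nG x
... | x′ , c = inj₂ ((x′ , y) , inj₁ c , inj₁ c , inj₁ c)

-- Opposite corners of a square differ in both coordinates, while an edge of `G □ H` keeps one
-- fixed.
□-corner : (G H : Graph) → ∀ {x x′ y y′} → Adj G x x′ → Adj H y y′ →
           ¬ Adj (G □ H) (x′ , y) (x , y′)
□-corner G H a b (inj₁ (_ , refl)) = irrefl H refl b
□-corner G H a b (inj₂ (refl , _)) = irrefl G refl a

□-unlinked : (G H : Graph) → ∀ {x x′ y y′} → Adj G x x′ → Adj H y y′ →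
             ¬ Linked (G □ H) (x , y) (x′ , y) (x , y′)
□-unlinked G H a b (inj₁ c) = □-corner G H a b c
-- A third neighbour along `G` is a corner opposite `(x , y′)`; in the last case, one along `H` is
-- opposite `(x′ , y)`.
□-unlinked G H a b (inj₂ (_ , inj₁ (c , refl) , _ , d)) =
  □-corner G H c b (symm (G □ H) d)
□-unlinked G H a b (inj₂ (_ , inj₂ (refl , c) , d , _)) = □-corner G H a c d

-- Only the common neighbour `z` is not given as an image under `to`; its preimage `from z` takes
-- its place.
Linked-reflect : (G H : Graph) (iso : G ≅ H) → let open _≅_ iso in
                 ∀ v u w → Linked H (to v) (to u) (to w) → Linked G v u w
Linked-reflect G H iso v u w = λ where
    (inj₁ a)               → inj₁ (Equivalence.from (adj⇔ u w) a)
    (inj₂ (z , a , b , c)) → inj₂ (from z , reflect v a , reflect u b , reflect w c)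
  where
  open _≅_ iso
  reflect : ∀ s {z} → Adj H (to s) z → Adj G s (from z)
  reflect s {z} a = Equivalence.from (adj⇔ s (from z))
    (subst (Adj H (to s)) (sym (Inverse.strictlyInverseˡ bijection z)) a)

theorem3p5 : (G H : Graph) → Connected G → Connected H →
    2 ≤ Graph.order G → 2 ≤ Graph.order H →
    ¬ (G □ H ≅ G ∘ H)
theorem3p5 G H connG connH 2≤G 2≤H iso =
  let nG = neighbour G connG 2≤G
      nH = neighbour H connH 2≤H
      x = vertex G 2≤G
      y = vertex H 2≤H
      x′ , a = nG x
      y′ , b = nH y
      v = x , y
      u = x′ , y
      w = x , y′
  in □-unlinked G H a b $ Linked-reflect (G □ H) (G ∘ H) iso v u w $
     ∘-linked G H nG nH (to v) (to u) (to w)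
       (Equivalence.to (adj⇔ v u) (inj₁ (a , refl)))
       (Equivalence.to (adj⇔ v w) (inj₂ (refl , b)))
  where open _≅_ iso
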